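{- Let $G=(V,E)$ be a tree on $n$ vertices, let $P$ be any valid search tree on $G$, and let $X=x_1,\dots,x_m$ be any sequence of vertices of $G$. Then $$\mathrm{OPT}(G,X)\;\ge\; \frac{I(G,P,X)}{2}-n .$$
   Context: Search tree on a tree: a rooted tree $T$ is a valid search tree on an unrooted tree $G$ if the root $r$ of $T$ is a vertex of $G$ and the subtrees of $T\setminus r$ are valid search trees on the connected components of $G\setminus r$ (there are no degree restrictions and no order among children). Rotation on a non-root node $v$ of $T$ with parent $p$: swap $p$ and $v$ (so $v$ takes $p$'s place and $p$ becomes a child of $v$); all children of $p$ remain children of $p$; for a child $u$ of $v$ with subtree node set $S_u$, if some node of $S_u$ is adjacent to $p$ in $G$ (this happens for at most one child) then $u$ becomes a child of $p$; all other children of $v$ remain children of $v$. GST model: a valid search tree $T$ on $G$ is maintained with a single pointer; at unit cost one may move the pointer to a child or the parent of the current node, or rotate the current node. A search for $v\in V$ is any sequence of unit-cost operations in which the pointer starts at the root of the current tree and points to $v$ at some point. $\mathrm{OPT}(G,X)$ is the minimum total number of unit-cost operations of any GST-model algorithm (even one knowing $X$ in advance) executing the searches $x_1,\dots,x_m$ in order, starting from any initial valid search tree on $G$. Preferred child: for a fixed search tree $P$ on $G$ and a non-leaf node $y$ of $P$ with children $y_1,\dots,y_d$ (with $y_1$ a fixed designated child), at time $t\in\{1,\dots,m\}$ the preferred child of $y$ is the child $y_i$ whose subtree $P(y_i)$ contains the most recent searched vertex among $x_1,\dots,x_t$ lying in the subtree $P(y)$; it is undefined if no such search exists, and if that most recent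 search is to $y$ itself, the preferred child is $y_1$. Interleave bound: the interleave bound of a node $y$ of $P$ is the number of times its preferred child changes over times $1,2,\dots,m$; $I(G,P,X)$ is the sum of the interleave bounds of all nodes of $P$ (here $P$ is fixed and does not change). -}

module Defs where

open import Level using (0ℓ)
open import Data.Fin.Base using (Fin; toℕ; fromℕ<)
open import Data.Fin.Properties using (_≟_; any?; pigeonhole; toℕ-fromℕ<; toℕ<n)
open import Data.List.Base using (List; []; _∷_; _∷ʳ_; map; allFin)
open import Data.List.Relation.Unary.Linked using (Linked)
open import Data.List.Relation.Unary.Unique.Propositional using (Unique)
open import Data.Maybe using (Maybe; just; nothing; fromMaybe; Is-just)
open import Data.Maybe.Properties using (≡-dec)
open import Data.Nat.Base using (ℕ; zero; suc; _+_; _∸_; _≤_; _<_; NonZero)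
open import Data.Nat.GeneralisedArithmetic using (iterate)
open import Data.Nat.Induction using (<-rec)
open import Data.Nat.ListAction using (sum)
open import Data.Nat.Properties
  using (_<?_; ≮⇒≥; ≤-trans; ≤-reflexive; n<1+n; m+[n∸m]≡n; +-monoˡ-<; ≤-pred)
open import Data.Product.Base using (∃; _×_; _,_)
open import Relation.Binary.Construct.Closure.ReflexiveTransitive using (Star; ε; _◅_)
open import Relation.Binary.Core using (Rel)
open import Relation.Binary.Definitions using (Decidable; Symmetric)
open import Relation.Binary.PropositionalEquality
  using (_≡_; _≢_; refl; sym; trans; cong)
open import Relation.Nullary using (¬_; Dec; yes; no)
open import Relation.Nullary.Decidable using (_×-dec_; map′)
open import Relation.Unary using (Pred; _∈_; U)

record Graph (n : ℕ) : Set₁ where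
  infix 4 _~_ _~?_
  field
    _~_     : Rel (Fin n) 0ℓ
    _~?_    : Decidable _~_
    ~-sym   : Symmetric _~_
    ~-irrefl : ∀ {v} → ¬ (v ~ v)

module _ {n : ℕ} (G : Graph n) where
  open Graph G

  Connected : Set
  Connected = ∀ u v → Star _~_ u v

  Acyclic : Set
  Acyclic = ∀ x y z zs → Unique (x ∷ y ∷ z ∷ zs) → ¬ Linked _~_ ((x ∷ y ∷ z ∷ zs) ∷ʳ x)

  record IsTree : Set where
    field
      nonempty  : NonZero n
      connected : Connected
      acyclic   : Acyclic

  -- Component S u is the vertex set of the connected component of u in the
  -- subgraph of G induced by S (meaningful for u ∈ S).
  Component : Pred (Fin n) 0ℓ → Fin n → Pred (Fin n) 0ℓ
  Component S u w = Star (λ a b → a ∈ S × b ∈ S × a ~ b) u w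

-- Rooted trees, as parent maps: the root is mapped to nothing.  There is
-- thus no order among children.  That a parent map really describes a
-- rooted tree is part of IsSearchTree.

ParentMap : ℕ → Set
ParentMap n = Fin n → Maybe (Fin n)

IsRoot : ∀ {n} → ParentMap n → Pred (Fin n) 0ℓ
IsRoot T r = T r ≡ nothing

ChildOf : ∀ {n} → ParentMap n → Rel (Fin n) 0ℓ
ChildOf T c p = T c ≡ just p

Subtree : ∀ {n} → ParentMap n → Fin n → Pred (Fin n) 0ℓ
Subtree T y x = Star (ChildOf T) x y

infixl 6 _∖_
_∖_ : ∀ {n} → Pred (Fin n) 0ℓ → Fin n → Pred (Fin n) 0ℓ
(S ∖ r) v = v ∈ S × v ≢ r

-- IsSearchTreeOn G T S r: the part of T hanging from r is a valid search tree
-- on the subgraph of G induced by S.  Distinct children of r automatically lie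
-- in distinct components: every non-root vertex of a search tree on a component
-- has its parent inside that component, whereas the parent of a child of r is r.
data IsSearchTreeOn {n} (G : Graph n) (T : ParentMap n)
                    (S : Pred (Fin n) 0ℓ) (r : Fin n) : Set where
  node : r ∈ S
       → (∀ {c} → ChildOf T c r →
            c ∈ S ∖ r × IsSearchTreeOn G T (Component G (S ∖ r) c) c)
       → (∀ {u} → u ∈ S ∖ r →
            ∃ λ c → ChildOf T c r × u ∈ Component G (S ∖ r) c)
       → IsSearchTreeOn G T S r

IsSearchTree : ∀ {n} → Graph n → ParentMap n → Set
IsSearchTree G T = ∃ λ r → IsRoot T r × IsSearchTreeOn G T U r

module GST {n : ℕ} (G : Graph n) where
  open Graph G

  -- Rotation T v T′: T′ is the result of rotating the non-root node v of T.
  record Rotation (T : ParentMap n) (v : Fin n) (T′ : ParentMap n) : Set where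
    field
      p      : Fin n
      v-p    : ChildOf T v p
      at-v   : T′ v ≡ T p
      at-p   : T′ p ≡ just v
      moved  : ∀ {u} → ChildOf T u v →
               (∃ λ w → w ∈ Subtree T u × w ~ p) → T′ u ≡ just p
      kept   : ∀ {u} → ChildOf T u v →
               ¬ (∃ λ w → w ∈ Subtree T u × w ~ p) → T′ u ≡ just v
      others : ∀ {u} → u ≢ v → u ≢ p → ¬ ChildOf T u v → T′ u ≡ T u

  -- The current tree and the position of the pointer.
  State : Set
  State = ParentMap n × Fin n

  data Step : Rel State 0ℓ where
    to-parent : ∀ {T v p}  → ChildOf T v p   → Step (T , v) (T , p)
    to-child  : ∀ {T v c}  → ChildOf T c v   → Step (T , v) (T , c)
    rotate    : ∀ {T v T′} → Rotation T v T′ → Step (T , v) (T′ , v)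

  data Steps : ℕ → Rel State 0ℓ where
    []  : ∀ {s} → Steps 0 s s
    _∷_ : ∀ {k s t u} → Step s t → Steps k t u → Steps (suc k) s u

  -- Search x T T′ k: a search for x with k operations turning T into T′.
  -- Operations may still be performed after the pointer has visited x.
  data Search (x : Fin n) (T T′ : ParentMap n) : ℕ → Set where
    search : ∀ {r T₁ q k l} → IsRoot T r →
             Steps k (T , r) (T₁ , x) → Steps l (T₁ , x) (T′ , q) →
             Search x T T′ (k + l)

  -- Execution T X k: starting from T, the searches X are executed in order with
  -- k operations in total.
  data Execution : ParentMap n → List (Fin n) → ℕ → Set where
    []  : ∀ {T} → Execution T [] 0
    _∷_ : ∀ {T T′ x X k l} → Search x T T′ k → Execution T′ X l →
          Execution T (x ∷ X) (k + l)

  Achievable : List (Fin n) → ℕ → Set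
  Achievable X k = ∃ λ T₀ → IsSearchTree G T₀ × Execution T₀ X k

-- IsOPT G X k: k = OPT(G,X).
record IsOPT {n} (G : Graph n) (X : List (Fin n)) (k : ℕ) : Set where
  open GST G
  field
    achievable : Achievable X k
    minimal    : ∀ {l} → Achievable X l → k ≤ l

module _ {n : ℕ} (T : ParentMap n) where

  private
    up : Fin n → Fin n
    up x = fromMaybe x (T x)

    iterate-+ : ∀ x a b → iterate up x (a + b) ≡ iterate up (iterate up x a) b
    iterate-+ x zero    b = refl
    iterate-+ x (suc a) b = iterate-+ (up x) a b

    iterate⇒subtree : ∀ {y} k x → iterate up x k ≡ y → x ∈ Subtree T y
    iterate⇒subtree zero    x refl = ε
    iterate⇒subtree (suc k) x eq with T x in Tx
    ... | nothing = iterate⇒subtree k x eq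
    ... | just p  = Tx ◅ iterate⇒subtree k p eq

    subtree⇒iterate : ∀ {x y} → x ∈ Subtree T y → ∃ λ k → iterate up x k ≡ y
    subtree⇒iterate ε = 0 , refl
    subtree⇒iterate {x} {y} (Tx ◅ s) with k , eq ← subtree⇒iterate s =
      suc k , trans (cong (λ m → iterate up (fromMaybe x m) k) Tx) eq

    shorten : ∀ {x y} k → iterate up x k ≡ y →
              ∃ λ (i : Fin n) → iterate up x (toℕ i) ≡ y
    shorten {x} {y} = <-rec _ go
      where
      go : ∀ k → (∀ {l} → l < k → iterate up x l ≡ y →
                  ∃ λ (i : Fin n) → iterate up x (toℕ i) ≡ y) →
           iterate up x k ≡ y → ∃ λ (i : Fin n) → iterate up x (toℕ i) ≡ y
      go k rec eq with k <? n
      ... | yes k<n = fromℕ< k<n , trans (cong (iterate up x) (toℕ-fromℕ< k<n)) eq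
      ... | no  k≮n
        with i , j , i<j , same ← pigeonhole (n<1+n n) (λ i → iterate up x (toℕ i)) =
          rec shorter
            (trans (iterate-+ x (toℕ i) d)
            (trans (cong (λ z → iterate up z d) same)
            (trans (sym (iterate-+ x (toℕ j) d))
            (trans (cong (iterate up x) j+d≡k) eq))))
        where
        d = k ∸ toℕ j
        j+d≡k : toℕ j + d ≡ k
        j+d≡k = m+[n∸m]≡n (≤-trans (≤-pred (toℕ<n j)) (≮⇒≥ k≮n))
        shorter : toℕ i + d < k
        shorter = ≤-trans (+-monoˡ-< d i<j) (≤-reflexive j+d≡k)

  subtree? : ∀ x y → Dec (x ∈ Subtree T y)
  subtree? x y = map′ (λ (i , eq) → iterate⇒subtree (toℕ i) x eq)
                      (λ s → let k , eq = subtree⇒iterate s in shorten k eq)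
                      (any? λ (i : Fin n) → iterate up x (toℕ i) ≟ y)

-- A choice, for every non-leaf node, of a designated child.
record Designation {n} (P : ParentMap n) : Set where
  field
    first       : Fin n → Maybe (Fin n)
    first-child : ∀ {y c} → first y ≡ just c → ChildOf P c y
    first-total : ∀ {y c} → ChildOf P c y → Is-just (first y)

module Interleave {n : ℕ} (P : ParentMap n) (D : Designation P) where
  open Designation D

  -- The argument is the list of the vertices searched so far, most recent first.
  -- In the last case x lies outside the subtree of y.
  preferred : List (Fin n) → Fin n → Maybe (Fin n)
  preferred []      y = nothing
  preferred (x ∷ h) y with x ≟ y
  ... | yes _ = first y
  ... | no  _ with any? (λ c → ≡-dec _≟_ (P c) (just y) ×-dec subtree? P x c)
  ...   | yes (c , _) = just c
  ...   | no  _       = preferred h y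

  -- Number of changes of the preferred child of y during the searches X, performed
  -- after those in h.
  changes : List (Fin n) → List (Fin n) → Fin n → ℕ
  changes h []      y = 0
  changes h (x ∷ X) y with ≡-dec _≟_ (preferred h y) (preferred (x ∷ h) y)
  ... | yes _ = changes (x ∷ h) X y
  ... | no  _ = suc (changes (x ∷ h) X y)

  -- Time 0, when every preferred child is undefined, is the reference for time 1:
  -- a preferred child becoming defined counts as a change.
  nodeBound : List (Fin n) → Fin n → ℕ
  nodeBound X y = changes [] X y

interleaveBound : ∀ {n} (P : ParentMap n) → Designation P → List (Fin n) → ℕ
interleaveBound {n} P D X = sum (map (Interleave.nodeBound P D X) (allFin n))

{-# OPTIONS --safe #-}

-- For a node y of P with children y₁, …, y_d, the vertices of P(y) are divided
-- into the regions P(y₁) ∪ {y}, P(y₂), …, P(y_d), each connected in G.  In any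
-- search tree T, a connected set has a top: a member that is an ancestor of all
-- the others.  The top of P(y) is the top of one region, which dominates y; the
-- tops of the other regions are the transition nodes of y.  A node is a
-- transition node of at most one y, so a step of the algorithm, charged to the y
-- for which the node it arrives at (or rotates) is a transition node, is charged
-- at most once.  Without a charge to y, a search leaves the dominating region
-- unchanged and can only reach a vertex of P(y) in the dominating region.
-- Keeping a credit of 1 for y while its preferred child is not the dominating
-- one (and 2 while it is undefined), every change is paid by two units per
-- charge.

module Submission where

open import Defs
open import Data.Nat using (ℕ)
open import Data.Fin using (Fin)
open import Data.List using (List)
open import Data.Integer using (+_)
open import Data.Rational using (_/_; _-_; _≥_)

open import Data.Bool.Base using (if_then_else_)
open import Data.Empty using (⊥-elim)
open import Data.Fin.Properties using (_≟_; any?; all?)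
import Data.Integer.Base as ℤ
import Data.Integer.Properties as ℤ
import Data.Integer.Solver as ℤSolver
open import Data.List.Base using ([]; _∷_; map; allFin; length)
open import Data.List.Membership.Propositional using () renaming (_∈_ to _∈ˡ_)
open import Data.List.Membership.Propositional.Properties using (∈-allFin)
open import Data.List.Properties using (length-tabulate)
open import Data.List.Relation.Unary.All using (All; []; _∷_)
open import Data.List.Relation.Unary.AllPairs using ([]; _∷_)
open import Data.List.Relation.Unary.Any using (here; there)
open import Data.List.Relation.Unary.Unique.Propositional using (Unique)
open import Data.List.Relation.Unary.Unique.Propositional.Properties using (allFin⁺)
open import Data.Maybe.Base using (Maybe; just; nothing)
open import Data.Maybe.Properties using (just-injective; ≡-dec)
open import Data.Nat.Base using (zero; suc; _+_; _*_; _≤_; z≤n; s≤s)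
open import Data.Nat.ListAction using (sum)
open import Data.Nat.Properties
  using (≤-refl; ≤-trans; ≤-reflexive; +-mono-≤; +-monoʳ-≤; *-monoʳ-≤; m≤m+n; m≤n+m; m≤n⇒m≤o+n;
         n≤1+n; +-suc; *-comm; *-zeroʳ; module ≤-Reasoning)
open import Data.Nat.Solver using (module +-*-Solver)
open import Data.Product.Base using (∃; _×_; _,_; proj₁; proj₂)
import Data.Rational.Properties as ℚ
import Data.Rational.Unnormalised.Base as ℚᵘ
import Data.Rational.Unnormalised.Properties as ℚᵘ
open import Data.Sum.Base using (_⊎_; inj₁; inj₂; [_,_]; swap)
open import Function.Base using (id)
open import Level using (0ℓ)
open import Relation.Binary.Construct.Closure.ReflexiveTransitive
  using (Star; ε; _◅_; _◅◅_; reverse)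
open import Relation.Binary.PropositionalEquality
  using (_≡_; _≢_; refl; sym; trans; cong; cong₂; subst; subst₂)
open import Relation.Nullary using (¬_; Dec; yes; no; does)
open import Relation.Nullary.Decidable using (_×-dec_; _⊎-dec_; _→-dec_; ¬?)
open import Relation.Unary using (Pred; _∈_; _⊆_; U; Decidable)

-- Sums over lists

module _ {A : Set} where

  sum-map-+ : ∀ (f g : A → ℕ) xs →
              sum (map (λ x → f x + g x) xs) ≡ sum (map f xs) + sum (map g xs)
  sum-map-+ f g []       = refl
  sum-map-+ f g (x ∷ xs) = trans (cong (λ m → (f x + g x) + m) (sum-map-+ f g xs))
    (solve 4 (λ a b c d → a :+ b :+ (c :+ d) := a :+ c :+ (b :+ d)) refl
      (f x) (g x) (sum (map f xs)) (sum (map g xs)))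
    where open +-*-Solver

  sum-map-mono : ∀ {f g : A → ℕ} → (∀ x → f x ≤ g x) → ∀ xs →
                 sum (map f xs) ≤ sum (map g xs)
  sum-map-mono f≤g []       = z≤n
  sum-map-mono f≤g (x ∷ xs) = +-mono-≤ (f≤g x) (sum-map-mono f≤g xs)

  sum-map-const : ∀ c (xs : List A) → sum (map (λ _ → c) xs) ≡ length xs * c
  sum-map-const c []       = refl
  sum-map-const c (x ∷ xs) = cong (λ m → c + m) (sum-map-const c xs)

indicator : ∀ {A : Set} → Dec A → ℕ
indicator d = if does d then 1 else 0

indicator-yes : ∀ {A : Set} (d : Dec A) → A → 1 ≤ indicator d
indicator-yes (yes _) a = ≤-refl
indicator-yes (no ¬a) a = ⊥-elim (¬a a)

module _ {A : Set} {Q : Pred A 0ℓ} (Q? : Decidable Q)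
         (unique : ∀ {x y} → Q x → Q y → x ≡ y) where

  private
    count : List A → ℕ
    count xs = sum (map (λ x → indicator (Q? x)) xs)

    count-others : ∀ {x} → Q x → ∀ {xs} → All (x ≢_) xs → count xs ≡ 0
    count-others q []                = refl
    count-others q (_∷_ {y} x≢y ne) with Q? y
    ... | yes q′ = ⊥-elim (x≢y (unique q q′))
    ... | no  _  = count-others q ne

  -- Turns the fact that a step can be charged to at most one `y` into the bound 1 on its total
  -- charge over all `y`.
  count≤1 : ∀ {xs} → Unique xs → count xs ≤ 1
  count≤1 []                = z≤n
  count≤1 (_∷_ {x} ne u) with Q? x
  ... | yes q = s≤s (≤-reflexive (count-others q ne))
  ... | no  _ = count≤1 u

-- Parent maps

module _ {n} {T : ParentMap n} where

  parent-unique : ∀ {x p q} → ChildOf T x p → ChildOf T x q → p ≡ q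
  parent-unique xp xq = just-injective (trans (sym xp) xq)

  above-root : ∀ {r x} → IsRoot T r → Subtree T x r → r ≡ x
  above-root Tr ε        = refl
  above-root Tr (Tx ◅ _) with () ← trans (sym Tr) Tx

  ancestors-comparable : ∀ {x a b} → Subtree T a x → Subtree T b x →
                         Subtree T a b ⊎ Subtree T b a
  ancestors-comparable ε         s         = inj₂ s
  ancestors-comparable s@(_ ◅ _) ε         = inj₁ s
  ancestors-comparable (xp ◅ s)  (xq ◅ s′) with refl ← parent-unique xp xq =
    ancestors-comparable s s′

-- Ancestors in valid trees

module _ {n} (G : Graph n) where
  open Graph G

  ConnectedIn : Pred (Fin n) 0ℓ → Set
  ConnectedIn S = ∀ {u w} → u ∈ S → w ∈ S → w ∈ Component G S u

  -- The part of being a search tree that the lower bound uses.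
  record Valid (T : ParentMap n) : Set where
    field
      {root}     : Fin n
      is-root    : IsRoot T root
      reach      : ∀ x → x ∈ Subtree T root
      comparable : ∀ {a b} → a ~ b → a ∈ Subtree T b ⊎ b ∈ Subtree T a

    -- A cycle through `x` also passes through its parent, so it can be pushed up the path to the
    -- root, which has no parent.
    acyclic : ∀ {x p} → ChildOf T x p → ¬ Subtree T x p
    acyclic {x} = go (reach x)
      where
      go : ∀ {x p} → Subtree T root x → ChildOf T x p → ¬ Subtree T x p
      go ε          xp s with () ← trans (sym is-root) xp
      go (xp ◅ up)  xq s with refl ← parent-unique {T = T} xp xq | s
      ... | ε       = go up xp ε
      ... | pq ◅ s′ = go up pq (s′ ◅◅ xp ◅ ε)

    antisym : ∀ {x y} → Subtree T x y → Subtree T y x → x ≡ y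
    antisym ε         _ = refl
    antisym (yq ◅ s) s′ = ⊥-elim (acyclic yq (s ◅◅ s′))

  -- Tops of connected sets

  module _ {T : ParentMap n} (valid : Valid T) {S : Pred (Fin n) 0ℓ} where
    open Valid valid

    -- Induction on the path from `t` to `w`. Consecutive vertices are comparable; when `t` is above
    -- the next vertex, `t` and the ancestor `a` found for the rest share a descendant, and the
    -- higher of the two serves.
    common-ancestor : ∀ {t w} → t ∈ S → w ∈ Component G S t →
                      ∃ λ a → a ∈ S × Subtree T a t × Subtree T a w
    common-ancestor {t} t∈S ε = t , t∈S , ε , ε
    common-ancestor {t} t∈S ((_ , t₁∈S , t~t₁) ◅ path)
      with a , a∈S , at₁ , aw ← common-ancestor t₁∈S path | comparable t~t₁
    ... | inj₁ tt₁ = a , a∈S , tt₁ ◅◅ at₁ , aw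
    ... | inj₂ t₁t with ancestors-comparable at₁ t₁t
    ...   | inj₁ at = a , a∈S , at , aw
    ...   | inj₂ ta = t , t∈S , ε , aw ◅◅ ta

    -- Folds `common-ancestor` over all vertices: the candidate only ever moves up, so it stays
    -- above the members already seen.
    top : Decidable S → ConnectedIn S → ∀ {u} → u ∈ S →
          ∃ λ t → t ∈ S × (∀ {w} → w ∈ S → Subtree T t w)
    top S? conn {u} u∈S =
      let t , t∈S , below = over (allFin n) in t , t∈S , λ {w} → below (∈-allFin w)
      where
      over : ∀ xs → ∃ λ t → t ∈ S × (∀ {w} → w ∈ˡ xs → w ∈ S → Subtree T t w)
      over []       = u , u∈S , λ ()
      over (x ∷ xs) with t , t∈S , below ← over xs | S? x
      ... | no  x∉S = t , t∈S , λ where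
        (here refl) w∈S → ⊥-elim (x∉S w∈S)
        (there w∈)  w∈S → below w∈ w∈S
      ... | yes x∈S with a , a∈S , at , ax ← common-ancestor t∈S (conn t∈S x∈S) =
        a , a∈S , λ where
          (here refl) _   → ax
          (there w∈)  w∈S → below w∈ w∈S ◅◅ at

  -- Search trees

  component-reverse : ∀ {S u w} → w ∈ Component G S u → u ∈ Component G S w
  component-reverse = reverse λ (a , b , ab) → b , a , ~-sym ab

  component-⊆ : ∀ {S u} → u ∈ S → Component G S u ⊆ S
  component-⊆ u∈S ε                   = u∈S
  component-⊆ u∈S ((_ , v∈S , _) ◅ s) = component-⊆ v∈S s

  component-connected : ∀ {S c} → ConnectedIn (Component G S c)
  component-connected {S} {c} cu cw =
    component-reverse (lift ε cu) ◅◅ lift ε cw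
    where
    lift : ∀ {a w} → Component G S c a → Component G S a w →
           Component G (Component G S c) a w
    lift ca ε                  = ε
    lift ca (e@(_ , _ , ab) ◅ s) = (ca , cb , ab) ◅ lift cb s
      where cb = ca ◅◅ e ◅ ε

  module _ {T : ParentMap n} where

    searchTree-reach : ∀ {S r u} → IsSearchTreeOn G T S r → u ∈ S → Subtree T r u
    searchTree-reach {r = r} {u} (node _ child split) u∈S with u ≟ r
    ... | yes refl = ε
    ... | no u≢r with c , cr , u∈c ← split (u∈S , u≢r) =
      searchTree-reach (proj₂ (child cr)) u∈c ◅◅ cr ◅ ε

    -- Adjacent vertices other than `r` share a component of `S ∖ r`, so the recursion follows both
    -- into one child's subtree until one of them is its root.
    searchTree-comparable :
      ∀ {S r u w} → IsSearchTreeOn G T S r → u ∈ S → w ∈ S → u ~ w →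
      u ∈ Subtree T w ⊎ w ∈ Subtree T u
    searchTree-comparable {r = r} {u} {w} t@(node _ child split) u∈S w∈S u~w
      with u ≟ r | w ≟ r
    ... | yes refl | _        = inj₂ (searchTree-reach t w∈S)
    ... | no _     | yes refl = inj₁ (searchTree-reach t u∈S)
    ... | no u≢r   | no w≢r with c , cr , u∈c ← split (u∈S , u≢r) =
      searchTree-comparable (proj₂ (child cr)) u∈c
        (u∈c ◅◅ ((u∈S , u≢r) , (w∈S , w≢r) , u~w) ◅ ε) u~w

    searchTree-descend :
      ∀ {S r u} → IsSearchTreeOn G T S r → ConnectedIn S → Subtree T r u →
      ∃ λ S′ → S′ ⊆ S × ConnectedIn S′ × IsSearchTreeOn G T S′ u
    searchTree-descend {S} t conn ε = S , id , conn , t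
    searchTree-descend t conn (up ◅ s)
      with S′ , S′⊆S , _ , node _ child _ ← searchTree-descend t conn s
      with c∈S′ , tᶜ ← child up =
      _ , (λ w∈ → S′⊆S (proj₁ (component-⊆ c∈S′ w∈))) , component-connected , tᶜ

    -- On a path in `S` from `c` to `r`, the vertex just before the first visit to `r` is still in
    -- the component of `c`.
    child-adjacent :
      ∀ {S r c} → IsSearchTreeOn G T S r → ConnectedIn S → ChildOf T c r →
      ∃ λ w → w ∈ Subtree T c × r ~ w
    child-adjacent {S} {r} {c} (node r∈S child _) conn cr =
      walk ε (conn (proj₁ c∈) r∈S)
      where
      c∈ = proj₁ (child cr)
      walk : ∀ {a} → Component G (S ∖ r) c a → Component G S a r →
             ∃ λ w → w ∈ Subtree T c × r ~ w
      walk r∈c ε = ⊥-elim (proj₂ (component-⊆ c∈ r∈c) refl)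
      walk {a} a∈c (_◅_ {j = b} (_ , b∈S , a~b) s) with b ≟ r
      ... | yes refl = a , searchTree-reach (proj₂ (child cr)) a∈c , ~-sym a~b
      ... | no  b≢r  =
        walk (a∈c ◅◅ (component-⊆ c∈ a∈c , (b∈S , b≢r) , a~b) ◅ ε) s

    searchTree-valid : IsSearchTree G T → Valid T
    searchTree-valid (r , Tr , t) = record
      { is-root    = Tr
      ; reach      = λ x → searchTree-reach t _
      ; comparable = searchTree-comparable t _ _
      }

    module _ (connected : Connected G) (st : IsSearchTree G T) where

      private
        U-connected : ConnectedIn U
        U-connected {u} {w} _ _ = go (connected u w)
          where
          go : ∀ {u w} → Star _~_ u w → Component G U u w
          go ε       = ε
          go (e ◅ s) = (_ , _ , e) ◅ go s

        searchTree-at : ∀ y → ∃ λ S → ConnectedIn S × IsSearchTreeOn G T S y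
        searchTree-at y
          with S , _ , conn , t ← searchTree-descend (proj₂ (proj₂ st)) U-connected
                                    (Valid.reach (searchTree-valid st) y) =
          S , conn , t

      -- The connected set `S` on which the part of `T` below `y` is a search tree consists of the
      -- descendants of `y`: `member` gives one inclusion, `searchTree-reach` the other.
      subtree-connected : ∀ y → ConnectedIn (Subtree T y)
      subtree-connected y uy wy with S , conn , t ← searchTree-at y =
        widen (conn (member uy) (member wy))
        where
        member : Subtree T y ⊆ S
        member s with S′ , S′⊆S , _ , node u∈S′ _ _ ← searchTree-descend t conn s =
          S′⊆S u∈S′
        widen : ∀ {a b} → Component G S a b → Component G (Subtree T y) a b
        widen ε                      = ε
        widen ((a∈ , b∈ , ab) ◅ s) =
          (searchTree-reach t a∈ , searchTree-reach t b∈ , ab) ◅ widen s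

      subtree-adjacent : ∀ {c y} → ChildOf T c y → ∃ λ w → w ∈ Subtree T c × y ~ w
      subtree-adjacent {y = y} cy with S , conn , t ← searchTree-at y =
        child-adjacent t conn cy

-- Rotations

module _ {n} {G : Graph n} {T v T′} (rot : GST.Rotation G T v T′) where
  open Graph G
  open GST.Rotation rot

  private
    Attached : Fin n → Set
    Attached u = ∃ λ w → w ∈ Subtree T u × w ~ p

    attached? : ∀ u → Dec (Attached u)
    attached? u = any? λ w → subtree? T w u ×-dec (w ~? p)

    child-of-v : ∀ {u} → ChildOf T u v →
                 ChildOf T′ u p ⊎ (ChildOf T′ u v × ¬ Attached u)
    child-of-v {u} uv with attached? u
    ... | yes a = inj₁ (moved uv a)
    ... | no ¬a = inj₂ (kept uv ¬a , ¬a)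

    -- The fate of a parent edge of `T`. The constructor `to-v` records that `x` is not attached,
    -- which `parent-subtree` uses.
    data Edge (x q : Fin n) : Set where
      at-v′    : x ≡ v → q ≡ p → Edge x q
      at-p′    : x ≡ p → Edge x q
      to-p     : q ≡ v → ChildOf T′ x p → Edge x q
      to-v     : q ≡ v → ChildOf T′ x v → ¬ Attached x → Edge x q
      same     : ChildOf T′ x q → Edge x q

    edge : ∀ {x q} → ChildOf T x q → Edge x q
    edge {x} {q} xq with x ≟ v | x ≟ p | q ≟ v
    ... | yes refl | _        | _        = at-v′ refl (parent-unique {T = T} xq v-p)
    ... | no _     | yes refl | _        = at-p′ refl
    ... | no _     | no _     | yes refl with child-of-v xq
    ...   | inj₁ xp        = to-p refl xp
    ...   | inj₂ (xv , ¬a) = to-v refl xv ¬a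
    edge {x} {q} xq | no x≢v | no x≢p | no q≢v =
      same (trans (others x≢v x≢p λ xv → q≢v (parent-unique {T = T} xq xv)) xq)

    data Edge′ (x q : Fin n) : Set where
      at-v′ : x ≡ v → ChildOf T p q → Edge′ x q
      at-p′ : x ≡ p → q ≡ v → Edge′ x q
      from-v : ChildOf T x v → q ≡ p → Edge′ x q
      same  : ChildOf T x q → Edge′ x q

    edge′ : ∀ {x q} → ChildOf T′ x q → Edge′ x q
    edge′ {x} {q} xq with x ≟ v | x ≟ p | ≡-dec _≟_ (T x) (just v)
    ... | yes refl | _        | _      = at-v′ refl (trans (sym at-v) xq)
    ... | no _     | yes refl | _      = at-p′ refl (parent-unique {T = T′} xq at-p)
    ... | no x≢v   | no x≢p   | no ¬xv = same (trans (sym (others x≢v x≢p ¬xv)) xq)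
    ... | no _     | no _     | yes xv with child-of-v xv
    ...   | inj₁ xp       = from-v xv (parent-unique {T = T′} xq xp)
    ...   | inj₂ (xv′ , _) with refl ← parent-unique {T = T′} xq xv′ = same xv

  -- Only `p` can lose descendants: the path up from `b` survives except around `v` and `p`, whose
  -- order is swapped.
  rotate-subtree : ∀ {z b} → z ≢ p → Subtree T z b → Subtree T′ z b
  rotate-subtree z≢p ε = ε
  rotate-subtree z≢p (bq ◅ s) with edge bq
  ... | at-v′ refl refl with s
  ...   | ε       = ⊥-elim (z≢p refl)
  ...   | pq ◅ s′ = trans at-v pq ◅ rotate-subtree z≢p s′
  rotate-subtree z≢p (bq ◅ s) | at-p′ refl =
    at-p ◅ trans at-v bq ◅ rotate-subtree z≢p s
  rotate-subtree z≢p (bq ◅ s) | to-p refl bp = bp ◅ at-p ◅ rotate-subtree z≢p s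
  rotate-subtree z≢p (bq ◅ s) | to-v refl bv _ = bv ◅ rotate-subtree z≢p s
  rotate-subtree z≢p (bq ◅ s) | same bq′ = bq′ ◅ rotate-subtree z≢p s

  -- Dually, only `v` can gain descendants.
  unrotate-subtree : ∀ {z b} → z ≢ v → Subtree T′ z b → Subtree T z b
  unrotate-subtree z≢v ε = ε
  unrotate-subtree z≢v (bq ◅ s) with edge′ bq | unrotate-subtree z≢v s
  ... | at-v′ refl pq   | up       = v-p ◅ pq ◅ up
  ... | at-p′ refl refl | ε        = ⊥-elim (z≢v refl)
  ... | at-p′ refl refl | vq ◅ up  with refl ← parent-unique {T = T} vq v-p = up
  unrotate-subtree z≢v (bq ◅ s) | from-v bv refl | up = bv ◅ v-p ◅ up
  unrotate-subtree z≢v (bq ◅ s) | same bq′       | up = bq′ ◅ up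

  rotated-subtree : ∀ {b} → Subtree T p b → Subtree T′ v b
  rotated-subtree ε = at-p ◅ ε
  rotated-subtree (bq ◅ s) with edge bq
  ... | at-v′ refl _   = ε
  ... | at-p′ refl     = at-p ◅ ε
  ... | to-p _ bp      = bp ◅ at-p ◅ ε
  ... | to-v _ bv _    = bv ◅ ε
  ... | same bq′       = bq′ ◅ rotated-subtree s

  private
    parent-subtree : ∀ {b} → Subtree T p b →
      b ∈ Subtree T′ p ⊎ b ≡ v ⊎ (∃ λ u → Subtree T u b × ¬ Attached u)
    parent-subtree ε = inj₁ ε
    parent-subtree {b} (bq ◅ s) with edge bq | parent-subtree s
    ... | at-v′ refl _  | _                          = inj₂ (inj₁ refl)
    ... | at-p′ refl    | _                          = inj₁ ε
    ... | to-p _ bp     | _                          = inj₁ (bp ◅ ε)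
    ... | to-v _ _ ¬a   | _                          = inj₂ (inj₂ (b , ε , ¬a))
    ... | same bq′      | inj₁ qp                    = inj₁ (bq′ ◅ qp)
    ... | same _        | inj₂ (inj₂ (u , qu , ¬a))  = inj₂ (inj₂ (u , bq ◅ qu , ¬a))
    ... | same bv       | inj₂ (inj₁ refl)           with child-of-v bq
    ...   | inj₁ bp        = inj₁ (bp ◅ ε)
    ...   | inj₂ (_ , ¬a)  = inj₂ (inj₂ (b , ε , ¬a))

    -- Only `a = p` is at risk. A descendant that `p` loses is either `v`, which is now above `p`,
    -- or lies under an unattached child of `v` and so is not adjacent to `p`.
    rotate-comparable : ∀ {a b} → a ~ b → b ∈ Subtree T a →
                        a ∈ Subtree T′ b ⊎ b ∈ Subtree T′ a
    rotate-comparable {a} a~b ab with a ≟ p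
    ... | no  a≢p  = inj₂ (rotate-subtree a≢p ab)
    ... | yes refl with parent-subtree ab
    ...   | inj₁ s                    = inj₂ s
    ...   | inj₂ (inj₁ refl)          = inj₁ (at-p ◅ ε)
    ...   | inj₂ (inj₂ (u , bu , ¬a)) = ⊥-elim (¬a (_ , bu , ~-sym a~b))

  rotate-valid : Valid G T → Valid G T′
  rotate-valid valid with T p in Tp
  -- Here `p` was the root, so `v` becomes the root of `T′`.
  ... | nothing = record
    { is-root    = trans at-v Tp
    ; reach      = λ x → rotated-subtree
                     (subst (λ r → Subtree T r x) (sym (above-root Tp (reach p))) (reach x))
    ; comparable = λ ab → [ (λ s → swap (rotate-comparable (~-sym ab) s))
                          , rotate-comparable ab ] (comparable ab)
    }
    where open Valid valid
  ... | just p′ = record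
    { root       = root
    ; is-root    = trans (others root≢v root≢p root-no-child) is-root
    ; reach      = λ x → rotate-subtree root≢p (reach x)
    ; comparable = λ ab → [ (λ s → swap (rotate-comparable (~-sym ab) s))
                          , rotate-comparable ab ] (comparable ab)
    }
    where
    open Valid valid
    non-root : ∀ {q} → T root ≢ just q
    non-root eq with () ← trans (sym is-root) eq
    root≢v : root ≢ v
    root≢v refl = non-root v-p
    root≢p : root ≢ p
    root≢p refl = non-root Tp
    root-no-child : ¬ ChildOf T root v
    root-no-child = non-root

module _ {n} (G : Graph n) where
  open GST G

  steps-valid : ∀ {k T T′ q q′} → Valid G T → Steps k (T , q) (T′ , q′) → Valid G T′
  steps-valid valid []                  = valid
  steps-valid valid (to-parent _  ∷ ss) = steps-valid valid ss
  steps-valid valid (to-child _   ∷ ss) = steps-valid valid ss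
  steps-valid valid (rotate rot   ∷ ss) = steps-valid (rotate-valid rot valid) ss

module LowerBound {n} (G : Graph n) (tree : IsTree G)
                  (P : ParentMap n) (P-search : IsSearchTree G P) (D : Designation P) where
  open Graph G
  open GST G
  open Designation D
  open Interleave P D

  private
    module Pᵛ = Valid (searchTree-valid G P-search)
    P-connected = subtree-connected G (IsTree.connected tree) P-search

  -- Regions

  -- The vertex `y` joins the region of its designated child in agreement with `preferred`: a search
  -- for a vertex of `Region y k` makes `k` the preferred child of `y`.
  Region : Fin n → Fin n → Pred (Fin n) 0ℓ
  Region y k x = (x ≡ y × first y ≡ just k) ⊎ (ChildOf P k y × x ∈ Subtree P k)

  region? : ∀ y k → Decidable (Region y k)
  region? y k x = ((x ≟ y) ×-dec ≡-dec _≟_ (first y) (just k))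
            ⊎-dec (≡-dec _≟_ (P k) (just y) ×-dec subtree? P x k)

  region-⊆ : ∀ {y k} → Region y k ⊆ Subtree P y
  region-⊆ (inj₁ (refl , _)) = ε
  region-⊆ (inj₂ (ky , xk))  = xk ◅◅ ky ◅ ε

  region-child : ∀ {y k x} → Region y k x → ChildOf P k y
  region-child (inj₁ (_ , fy)) = first-child fy
  region-child (inj₂ (ky , _)) = ky

  -- Children with a common descendant are comparable, and if one were strictly below the other, the
  -- path between them would pass through `y` and close a cycle.
  children-disjoint : ∀ {y c c′ x} → ChildOf P c y → ChildOf P c′ y →
                      x ∈ Subtree P c → x ∈ Subtree P c′ → c ≡ c′
  children-disjoint cy c′y xc xc′ with ancestors-comparable xc xc′
  ... | inj₁ ε          = refl
  ... | inj₁ (c′q ◅ s)  with refl ← parent-unique {T = P} c′q c′y = ⊥-elim (Pᵛ.acyclic cy s)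
  children-disjoint cy c′y xc xc′ | inj₂ ε        = refl
  children-disjoint cy c′y xc xc′ | inj₂ (cq ◅ s)
    with refl ← parent-unique {T = P} cq cy = ⊥-elim (Pᵛ.acyclic c′y s)

  region-unique : ∀ {y k k′ x} → Region y k x → Region y k′ x → k ≡ k′
  region-unique (inj₁ (_ , fy))    (inj₁ (_ , fy′))   = just-injective (trans (sym fy) fy′)
  region-unique (inj₁ (refl , _))  (inj₂ (k′y , yk′)) = ⊥-elim (Pᵛ.acyclic k′y yk′)
  region-unique (inj₂ (ky , yk))   (inj₁ (refl , _))  = ⊥-elim (Pᵛ.acyclic ky yk)
  region-unique (inj₂ (ky , xk))   (inj₂ (k′y , xk′)) = children-disjoint ky k′y xk xk′

  last-step : ∀ {x y} → x ∈ Subtree P y → x ≡ y ⊎ (∃ λ c → ChildOf P c y × x ∈ Subtree P c)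
  last-step ε = inj₁ refl
  last-step {x} (xq ◅ s) with last-step s
  ... | inj₁ refl          = inj₂ (x , xq , ε)
  ... | inj₂ (c , cy , qc) = inj₂ (c , cy , xq ◅ qc)

  first-defined : ∀ {y c} → ChildOf P c y → ∃ λ k → first y ≡ just k
  first-defined {y} cy with first y | first-total cy
  ... | just k | _ = k , refl

  region-exists : ∀ {y c x} → ChildOf P c y → x ∈ Subtree P y → ∃ λ k → Region y k x
  region-exists cy xy with last-step xy
  ... | inj₁ refl with k , fy ← first-defined cy = k , inj₁ (refl , fy)
  region-exists cy xy | inj₂ (k , ky , xk) = k , inj₂ (ky , xk)

  -- Adding `y` to the subtree of its child `k` keeps it connected, because `y` is adjacent to some
  -- vertex of that subtree.
  region-connected : ∀ {y k} → ConnectedIn G (Region y k)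
  region-connected {y} {k} = go
    where
    widen : ∀ {u w} → ChildOf P k y → Component G (Subtree P k) u w →
            Component G (Region y k) u w
    widen ky ε                    = ε
    widen ky ((ak , bk , ab) ◅ s) = (inj₂ (ky , ak) , inj₂ (ky , bk) , ab) ◅ widen ky s

    from-y : first y ≡ just k → ∀ {w} → w ∈ Subtree P k → Component G (Region y k) y w
    from-y fy wk
      with ky ← first-child fy
      with a , ak , y~a ← subtree-adjacent G (IsTree.connected tree) P-search ky =
      (inj₁ (refl , fy) , inj₂ (ky , ak) , y~a) ◅ widen ky (P-connected k ak wk)

    go : ConnectedIn G (Region y k)
    go (inj₁ (refl , _))  (inj₁ (refl , _)) = ε
    go (inj₁ (refl , fy)) (inj₂ (_ , wk))   = from-y fy wk
    go (inj₂ (_ , uk))    (inj₁ (refl , fy)) = component-reverse G (from-y fy uk)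
    go (inj₂ (ky , uk))   (inj₂ (_ , wk))   = widen ky (P-connected k uk wk)

  -- Transition nodes and domination

  -- The last component says that `z`, the top of its region, is not above all of `P(y)`.
  TransitionVia : ParentMap n → Fin n → Fin n → Fin n → Set
  TransitionVia T y z k =
    Region y k z × (∀ w → Region y k w → w ∈ Subtree T z) ×
    ∃ λ w → w ∈ Subtree P y × ¬ w ∈ Subtree T z

  Transition : ParentMap n → Fin n → Fin n → Set
  Transition T y z = ∃ (TransitionVia T y z)

  transition? : ∀ T y z → Dec (Transition T y z)
  transition? T y z = any? λ k →
    region? y k z
      ×-dec (all? λ w → region? y k w →-dec subtree? T w z)
      ×-dec (any? λ w → subtree? P w y ×-dec ¬? (subtree? T w z))

  -- If `y′` is strictly below `y`, all of `P(y′)` lies in one region of `y`, the one containing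
  -- `z`. Then `z` is above all of `P(y′)`, against the escaping vertex `w`.
  transition-unique-below : ∀ {T y y′ z} → Transition T y z → Transition T y′ z →
                            y′ ∈ Subtree P y → y ≡ y′
  transition-unique-below {T} (k , zk , below , _) (k′ , zk′ , _ , w , wy′ , w≰z) y′y
    with last-step y′y
  ... | inj₁ refl = refl
  ... | inj₂ (c , cy , y′c)
    with refl ← region-unique zk (inj₂ (cy , region-⊆ zk′ ◅◅ y′c)) =
    ⊥-elim (w≰z (below w (inj₂ (cy , wy′ ◅◅ y′c))))

  transition-unique : ∀ {T z y y′} → Transition T y z → Transition T y′ z → y ≡ y′
  transition-unique t@(_ , zk , _) t′@(_ , zk′ , _)
    with ancestors-comparable (region-⊆ zk) (region-⊆ zk′)
  ... | inj₁ y′y = transition-unique-below t t′ y′y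
  ... | inj₂ yy′ = sym (transition-unique-below t′ t yy′)

  Dominates : ParentMap n → Fin n → Fin n → Set
  Dominates T y k = ∃ λ z → Region y k z × (∀ {w} → w ∈ Subtree P y → w ∈ Subtree T z)

  dominates-unique : ∀ {T y k k′} → Valid G T → Dominates T y k → Dominates T y k′ → k ≡ k′
  dominates-unique valid (z , zk , zb) (z′ , zk′ , zb′)
    with refl ← Valid.antisym valid (zb (region-⊆ zk′)) (zb′ (region-⊆ zk)) =
    region-unique zk zk′

  transition-or-dominates : ∀ {T y k x} → Valid G T → Region y k x →
                            (∃ λ z → TransitionVia T y z k) ⊎ Dominates T y k
  transition-or-dominates {T} {y} {k} valid xk
    with z , zk , below ← top G valid (region? y k) region-connected xk
    with any? (λ w → subtree? P w y ×-dec ¬? (subtree? T w z))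
  ... | yes escape = inj₁ (z , zk , (λ _ → below) , escape)
  ... | no  ¬esc   = inj₂ (z , zk , λ {w} wy → covers w wy (subtree? T w z))
    where
    covers : ∀ w → w ∈ Subtree P y → Dec (w ∈ Subtree T z) → w ∈ Subtree T z
    covers w wy (yes wz) = wz
    covers w wy (no ¬wz) = ⊥-elim (¬esc (w , wy , ¬wz))

  -- The top of `P(y)` can change only from `p` to `v`. If these lie in different regions, `v` was
  -- the top of its own region in `T`, hence a transition node, with `p` as the vertex of `P(y)`
  -- outside its subtree.
  dominates-rotate : ∀ {T v T′ y k} → Valid G T → Rotation T v T′ → Dominates T y k →
                     Transition T y v ⊎ Dominates T′ y k
  dominates-rotate {T} {v} {T′} {y} {k} valid rot (z , zk , zb)
    with t , ty , below ← top G (rotate-valid rot valid) (λ w → subtree? P w y)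
                                (P-connected y) {y} ε
    with t ≟ v
  ... | no t≢v
    with refl ← Valid.antisym valid (zb ty) (unrotate-subtree rot t≢v (below (region-⊆ zk))) =
    inj₂ (z , zk , below)
  ... | yes refl
    with z ≟ p
    where open Rotation rot
  ...   | no z≢p
    with refl ← Valid.antisym (rotate-valid rot valid)
                  (rotate-subtree rot z≢p (zb ty)) (below (region-⊆ zk)) =
    inj₂ (z , zk , below)
  ...   | yes refl with k′ , vk′ ← region-exists (region-child zk) ty | k ≟ k′
  ...     | yes refl = inj₂ (v , vk′ , below)
  ...     | no k≢k′  =
    inj₁ (k′ , vk′ , (λ _ → v-top) , p , region-⊆ zk , Valid.acyclic valid v-p)
    where
    open Rotation rot
    -- A top `s` strictly above `v` would be at or above `p`; but `p` is above all of `P(y)`, so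
    -- `s = p`, which belongs to region `k` and not to `k′`.
    v-top : ∀ {w} → Region y k′ w → w ∈ Subtree T v
    v-top wk′ with s , sk′ , s-top ← top G valid (region? y k′) region-connected vk′
              with s-top vk′
    ... | ε = s-top wk′
    ... | vq ◅ qs with refl ← parent-unique {T = T} vq v-p
                  with refl ← Valid.antisym valid qs (zb (region-⊆ sk′)) =
      ⊥-elim (k≢k′ (region-unique zk sk′))

  -- Charges

  -- A rotation is charged according to the tree before it.
  charge : ∀ {s t} → Fin n → Step s t → ℕ
  charge y (to-parent {T} {p = p} _) = indicator (transition? T y p)
  charge y (to-child {T} {c = c} _)  = indicator (transition? T y c)
  charge y (rotate {T} {v} _)        = indicator (transition? T y v)

  charges : ∀ {k s t} → Fin n → Steps k s t → ℕ
  charges y []       = 0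
  charges y (s ∷ ss) = charge y s + charges y ss

  searchCharges : ∀ {x T T′ k} → Fin n → Search x T T′ k → ℕ
  searchCharges y (search _ ss ss′) = charges y ss + charges y ss′

  executionCharges : ∀ {T X k} → Fin n → Execution T X k → ℕ
  executionCharges y []      = 0
  executionCharges y (s ∷ e) = searchCharges y s + executionCharges y e

  total : (Fin n → ℕ) → ℕ
  total f = sum (map f (allFin n))

  total-+ : ∀ {f g k l} → total f ≤ k → total g ≤ l → total (λ y → f y + g y) ≤ k + l
  total-+ {f} {g} f≤k g≤l =
    ≤-trans (≤-reflexive (sum-map-+ f g (allFin n))) (+-mono-≤ f≤k g≤l)

  total-0 : total (λ _ → 0) ≤ 0
  total-0 = ≤-reflexive (trans (sum-map-const 0 (allFin n)) (*-zeroʳ (length (allFin n))))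

  total-charge : ∀ {s t} (st : Step s t) → total (λ y → charge y st) ≤ 1
  total-charge (to-parent {T} {p = p} _) =
    count≤1 (λ y → transition? T y p) transition-unique (allFin⁺ n)
  total-charge (to-child {T} {c = c} _) =
    count≤1 (λ y → transition? T y c) transition-unique (allFin⁺ n)
  total-charge (rotate {T} {v} _) =
    count≤1 (λ y → transition? T y v) transition-unique (allFin⁺ n)

  total-charges : ∀ {k s t} (ss : Steps k s t) → total (λ y → charges y ss) ≤ k
  total-charges []       = total-0
  total-charges (s ∷ ss) = total-+ (total-charge s) (total-charges ss)

  total-executionCharges : ∀ {T X k} (e : Execution T X k) →
                           total (λ y → executionCharges y e) ≤ k
  total-executionCharges []                    = total-0
  total-executionCharges (search _ ss ss′ ∷ e) =
    total-+ (total-+ (total-charges ss) (total-charges ss′)) (total-executionCharges e)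

  -- The pointer stays outside the subtree of a transition node z, and z remains a
  -- transition node, until it moves from the parent of z to z.
  entry-charged : ∀ {y z k T T′ q x l} → TransitionVia T y z k →
                  ¬ q ∈ Subtree T z → Region y k x →
                  (ss : Steps l (T , q) (T′ , x)) → 1 ≤ charges y ss
  entry-charged (_ , below , _) q≰z xk [] = ⊥-elim (q≰z (below _ xk))
  entry-charged {y} tr q≰z xk (to-parent {T} {p = p} qp ∷ ss) =
    ≤-trans (entry-charged tr (λ pz → q≰z (qp ◅ pz)) xk ss)
            (m≤n+m _ (indicator (transition? T y p)))
  entry-charged {y} {z} tr q≰z xk (to-child {T} {c = c} cq ∷ ss) with subtree? T c z
  ... | no c≰z = ≤-trans (entry-charged tr c≰z xk ss)
                         (m≤n+m _ (indicator (transition? T y c)))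
  ... | yes ε  = ≤-trans (indicator-yes (transition? T y c) (_ , tr)) (m≤m+n _ _)
  ... | yes (cq′ ◅ q′z) with refl ← parent-unique {T = T} cq′ cq = ⊥-elim (q≰z q′z)
  entry-charged {y} {z} (zk , below , w , wy , w≰z) q≰z xk (rotate {T} {v} rot ∷ ss) =
    ≤-trans (entry-charged
              (zk , (λ w wk → rotate-subtree rot z≢p (below w wk)) ,
               w , wy , λ wz → w≰z (unrotate-subtree rot z≢v wz))
              (λ qz → q≰z (unrotate-subtree rot z≢v qz)) xk ss)
            (m≤n+m _ (indicator (transition? T y v)))
    where
    open Rotation rot
    -- The pointer is at `v`, outside the subtree of `z`, so `z` is neither `v` nor its parent and
    -- the rotation preserves the descendants of `z` both ways.
    z≢v : z ≢ v
    z≢v refl = q≰z ε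
    z≢p : z ≢ p
    z≢p refl = q≰z (v-p ◅ ε)

  -- If the region of `x` does not dominate, its top is a transition node, and the search has to
  -- enter the subtree of that top from the root.
  target-dominates : ∀ {y k x T T′ l} → Valid G T → Region y k x → (s : Search x T T′ l) →
                     1 ≤ searchCharges y s ⊎ Dominates T y k
  target-dominates {y} valid xk (search {r} Tr ss ss′) with transition-or-dominates valid xk
  ... | inj₂ dom = inj₂ dom
  ... | inj₁ (z , tr@(_ , _ , w , _ , w≰z)) =
    inj₁ (≤-trans (entry-charged tr r≰z xk ss) (m≤m+n _ _))
    where
    open Valid valid
    -- If the root were below `z`, it would be `z` itself, and then `w` would be below `z` too.
    r≰z : ¬ r ∈ Subtree _ z
    r≰z rz with refl ← above-root Tr rz | refl ← above-root Tr (reach r) = w≰z (reach w)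

  dominates-steps : ∀ {y k T T′ q q′ l} → Valid G T → Dominates T y k →
                    (ss : Steps l (T , q) (T′ , q′)) → 1 ≤ charges y ss ⊎ Dominates T′ y k
  dominates-steps valid dom [] = inj₂ dom
  dominates-steps valid dom (to-parent _ ∷ ss) with dominates-steps valid dom ss
  ... | inj₁ c    = inj₁ (≤-trans c (m≤n+m _ _))
  ... | inj₂ dom′ = inj₂ dom′
  dominates-steps valid dom (to-child _ ∷ ss) with dominates-steps valid dom ss
  ... | inj₁ c    = inj₁ (≤-trans c (m≤n+m _ _))
  ... | inj₂ dom′ = inj₂ dom′
  dominates-steps {y} valid dom (rotate {T} {v} rot ∷ ss) with dominates-rotate valid rot dom
  ... | inj₁ tr   = inj₁ (≤-trans (indicator-yes (transition? T y v) tr) (m≤m+n _ _))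
  ... | inj₂ dom₁ with dominates-steps (rotate-valid rot valid) dom₁ ss
  ...   | inj₁ c    = inj₁ (≤-trans c (m≤n+m _ _))
  ...   | inj₂ dom′ = inj₂ dom′

  dominates-search : ∀ {y k x T T′ l} → Valid G T → Dominates T y k → (s : Search x T T′ l) →
                     1 ≤ searchCharges y s ⊎ Dominates T′ y k
  dominates-search valid dom (search _ ss ss′) with dominates-steps valid dom ss
  ... | inj₁ c    = inj₁ (≤-trans c (m≤m+n _ _))
  ... | inj₂ dom₁ with dominates-steps (steps-valid G valid ss) dom₁ ss′
  ...   | inj₁ c    = inj₁ (≤-trans c (m≤n+m _ _))
  ...   | inj₂ dom′ = inj₂ dom′

  search-valid : ∀ {x T T′ l} → Valid G T → Search x T T′ l → Valid G T′
  search-valid valid (search _ ss ss′) = steps-valid G (steps-valid G valid ss) ss′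

  -- Preferred children

  -- Covers a search for a leaf `y` itself: `preferred` then returns `first y` without consulting
  -- the history, and this is no change.
  preferred-leaf : ∀ {y} → first y ≡ nothing → ∀ h → preferred h y ≡ nothing
  preferred-leaf fy [] = refl
  preferred-leaf {y} fy (x ∷ h) with x ≟ y
  ... | yes _ = fy
  ... | no  _ with any? (λ c → ≡-dec _≟_ (P c) (just y) ×-dec subtree? P x c)
  ...   | yes (c , cy , _) with k , fy′ ← first-defined cy with () ← trans (sym fy) fy′
  ...   | no  _ = preferred-leaf fy h

  preferred-search : ∀ x h y → (∃ λ k → Region y k x × preferred (x ∷ h) y ≡ just k)
                             ⊎ preferred h y ≡ preferred (x ∷ h) y
  preferred-search x h y with x ≟ y
  ... | yes refl with first y in fy
  ...   | just k  = inj₁ (k , inj₁ (refl , refl) , refl)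
  ...   | nothing = inj₂ (preferred-leaf fy h)
  preferred-search x h y | no _
    with any? (λ c → ≡-dec _≟_ (P c) (just y) ×-dec subtree? P x c)
  ...   | yes (c , r) = inj₁ (c , inj₂ r , refl)
  ...   | no  _       = inj₂ refl

  changes-same : ∀ x h y X → preferred h y ≡ preferred (x ∷ h) y →
                 changes h (x ∷ X) y ≡ changes (x ∷ h) X y
  changes-same x h y X eq with ≡-dec _≟_ (preferred h y) (preferred (x ∷ h) y)
  ... | yes _  = refl
  ... | no neq = ⊥-elim (neq eq)

  changes-≤-suc : ∀ x h y X → changes h (x ∷ X) y ≤ suc (changes (x ∷ h) X y)
  changes-≤-suc x h y X with ≡-dec _≟_ (preferred h y) (preferred (x ∷ h) y)
  ... | yes _ = n≤1+n _
  ... | no  _ = ≤-refl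

  -- Credits and the amortised bound

  data Credit (T : ParentMap n) (y : Fin n) : Maybe (Fin n) → ℕ → Set where
    undefined : Credit T y nothing 2
    defined   : ∀ {k} → Credit T y (just k) 1
    dominant  : ∀ {k} → Dominates T y k → Credit T y (just k) 0

  -- A charge yields two units, enough for the one credit of `defined`, which is available whether
  -- or not the preferred child dominates.
  credit-unchanged : ∀ {T T′ x l y m b} → Valid G T → (s : Search x T T′ l) → Credit T y m b →
                     ∃ λ b′ → Credit T′ y m b′ × b′ ≤ 2 * searchCharges y s + b
  credit-unchanged valid s undefined      = 2 , undefined , m≤n+m _ _
  credit-unchanged valid s defined        = 1 , defined , m≤n+m _ _
  credit-unchanged valid s (dominant dom) with dominates-search valid dom s
  ... | inj₁ c    = 1 , defined , ≤-trans (≤-trans (s≤s z≤n) (*-monoʳ-≤ 2 c)) (m≤m+n _ _)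
  ... | inj₂ dom′ = 0 , dominant dom′ , z≤n

  -- The arithmetic of one search: `s` counts its charges, `c` the later ones, and `b` and `b′` are
  -- the credits before and after it.
  pay : ∀ {a b b′ m} s c → m ≤ a → a ≤ 2 * c + b′ → b′ ≤ 2 * s + b → m ≤ 2 * (s + c) + b
  pay {a} {b} {b′} {m} s c m≤a a≤ b′≤ = begin
    m                       ≤⟨ m≤a ⟩
    a                       ≤⟨ a≤ ⟩
    2 * c + b′              ≤⟨ +-monoʳ-≤ (2 * c) b′≤ ⟩
    2 * c + (2 * s + b)     ≡⟨ solve 3 (λ b c s → con 2 :* c :+ (con 2 :* s :+ b)
                                               := con 2 :* (s :+ c) :+ b) refl b c s ⟩
    2 * (s + c) + b         ∎
    where
    open ≤-Reasoning
    open +-*-Solver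

  -- Amortised induction over the searches: two units per charge and the credit held before a search
  -- cover its change, if any, and the credit held after it.
  changes-bound : ∀ {T X k h y b} → Valid G T → (e : Execution T X k) →
                  Credit T y (preferred h y) b →
                  changes h X y ≤ 2 * executionCharges y e + b
  changes-bound valid [] cr = z≤n
  changes-bound {X = x ∷ X} {h = h} {y} {b} valid (_∷_ {T′ = T′} s e) cr =
    search-bound (preferred-search x h y)
    where
    sᶜ = searchCharges y s
    eᶜ = executionCharges y e
    Bound : ℕ → Set
    Bound b = changes h (x ∷ X) y ≤ 2 * (sᶜ + eᶜ) + b

    rest : ∀ {m b} → preferred (x ∷ h) y ≡ m → Credit T′ y m b →
           changes (x ∷ h) X y ≤ 2 * eᶜ + b
    rest refl cr′ = changes-bound (search-valid valid s) e cr′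

    changed : ∀ {m b b′} → preferred (x ∷ h) y ≡ m → Credit T′ y m b′ →
              suc b′ ≤ 2 * sᶜ + b → Bound b
    changed eq cr′ = pay sᶜ eᶜ (changes-≤-suc x h y X)
      (≤-trans (s≤s (rest eq cr′)) (≤-reflexive (sym (+-suc _ _))))

    -- Of the two units from a charge, one pays for the change and one becomes the credit of
    -- `defined`.
    charged : ∀ {k b} → preferred (x ∷ h) y ≡ just k → 1 ≤ sᶜ → Bound b
    charged eq c = changed eq defined (≤-trans (*-monoʳ-≤ 2 c) (m≤m+n _ _))

    -- With the region of `x` dominating before and after the search, a stored credit pays for the
    -- change. If none is stored, the old preferred child was dominant, so it is already `k` and
    -- nothing changes.
    settled : ∀ {k m b} → preferred (x ∷ h) y ≡ just k → preferred h y ≡ m →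
              Dominates _ y k → Dominates T′ y k → Credit _ y m b → Bound b
    settled eq eq₀ dom dom′ undefined = changed eq (dominant dom′) (m≤n⇒m≤o+n _ (s≤s z≤n))
    settled eq eq₀ dom dom′ defined   = changed eq (dominant dom′) (m≤n⇒m≤o+n _ ≤-refl)
    settled eq eq₀ dom dom′ (dominant dom₀) with refl ← dominates-unique valid dom₀ dom =
      pay sᶜ eᶜ (≤-reflexive (changes-same x h y X (trans eq₀ (sym eq))))
          (rest eq (dominant dom′)) z≤n

    renewed : ∀ {k} → Region y k x → preferred (x ∷ h) y ≡ just k →
              1 ≤ sᶜ ⊎ Dominates _ y k → Bound b
    renewed xk eq (inj₁ c)   = charged eq c
    renewed xk eq (inj₂ dom) =
      [ charged eq , (λ dom′ → settled eq refl dom dom′ cr) ] (dominates-search valid dom s)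

    search-bound : (∃ λ k → Region y k x × preferred (x ∷ h) y ≡ just k)
                 ⊎ preferred h y ≡ preferred (x ∷ h) y → Bound b
    search-bound (inj₁ (k , xk , eq)) = renewed xk eq (target-dominates valid xk s)
    search-bound (inj₂ eq) with b′ , cr′ , b′≤ ← credit-unchanged valid s cr =
      pay sᶜ eᶜ (≤-reflexive (changes-same x h y X eq)) (rest (sym eq) cr′) b′≤

  -- Sums `changes-bound` over all `y`: the charges total at most `k`, and the initial credits, 2
  -- for each `y`, give `2 * n`.
  interleave-bound : ∀ {X k} → Achievable X k → interleaveBound P D X ≤ 2 * k + 2 * n
  interleave-bound {X} {k} (T , T-search , e) = begin
    total (nodeBound X)                ≤⟨ sum-map-mono (λ y →
                                            changes-bound (searchTree-valid G T-search) e undefined)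
                                            (allFin n) ⟩
    total (λ y → 2 * executionCharges y e + 2)
                                       ≤⟨ total-+ double (≤-reflexive twos) ⟩
    2 * k + 2 * n                      ∎
    where
    open ≤-Reasoning
    charged = total-executionCharges e
    double : total (λ y → 2 * executionCharges y e) ≤ 2 * k
    -- `2 * c` unfolds to `c + (c + 0)`, whence `charged` twice and `total-0` once.
    double = total-+ charged (total-+ charged total-0)
    twos : total (λ _ → 2) ≡ 2 * n
    twos = trans (sum-map-const 2 (allFin n))
          (trans (cong (_* 2) (length-tabulate {n = n} id)) (*-comm n 2))

-- Passage to rational numbers

half-bound : ∀ i k m → i ≤ 2 * k + 2 * m → (+ k) / 1 ≥ (+ i) / 2 - (+ m) / 1
half-bound i k m i≤ = ℚ.toℚᵘ-cancel-≤ (begin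
  toℚᵘ (i/2 - m/1)                ≃⟨ ℚ.toℚᵘ-homo-+ i/2 (Data.Rational.- m/1) ⟩
  toℚᵘ i/2 ℚᵘ.+ toℚᵘ (Data.Rational.- m/1)
    ≃⟨ ℚᵘ.+-cong (ℚ.toℚᵘ-fromℚᵘ I)
         (ℚᵘ.≃-trans (ℚ.toℚᵘ-homo‿- m/1) (ℚᵘ.-‿cong (ℚ.toℚᵘ-fromℚᵘ M))) ⟩
  I ℚᵘ.- M                        ≤⟨ ℚᵘ.*≤* key ⟩
  K                               ≃⟨ ℚ.toℚᵘ-fromℚᵘ K ⟨
  toℚᵘ ((+ k) / 1)                ∎)
  where
  open ℚᵘ.≤-Reasoning
  open Data.Rational using (toℚᵘ)
  i/2 = (+ i) / 2
  m/1 = (+ m) / 1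
  -- `mkℚᵘ` takes the denominator minus one, so these are `i / 2`, `m / 1` and `k / 1`.
  I = ℚᵘ.mkℚᵘ (+ i) 1
  M = ℚᵘ.mkℚᵘ (+ m) 0
  K = ℚᵘ.mkℚᵘ (+ k) 0
  -- The inequality between `I - M` and `K`, cross-multiplied exactly as unnormalised rationals
  -- compute it.
  key : ((+ i) ℤ.* (+ 1) ℤ.+ (ℤ.- (+ m)) ℤ.* (+ 2)) ℤ.* (+ 1) ℤ.≤ (+ k) ℤ.* (+ 2)
  i≤ᶻ : + i ℤ.≤ (+ k) ℤ.* (+ 2) ℤ.+ (+ m) ℤ.* (+ 2)
  i≤ᶻ = subst (+ i ℤ.≤_) (cong₂ ℤ._+_ (ℤ.pos-* k 2) (ℤ.pos-* m 2))
          (ℤ.+≤+ (≤-trans i≤ (≤-reflexive (cong₂ _+_ (*-comm 2 k) (*-comm 2 m)))))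
  key = subst₂ ℤ._≤_
    (solve 2 (λ i m → i :+ :- (m :* con (+ 2))
                   := (i :* con (+ 1) :+ (:- m) :* con (+ 2)) :* con (+ 1)) refl (+ i) (+ m))
    (solve 2 (λ k m → k :* con (+ 2) :+ m :* con (+ 2) :+ :- (m :* con (+ 2))
                   := k :* con (+ 2)) refl (+ k) (+ m))
    (ℤ.+-monoˡ-≤ (ℤ.- ((+ m) ℤ.* (+ 2))) i≤ᶻ)
    where open ℤSolver.+-*-Solver

theorem1 : ∀ {n : ℕ} (G : Graph n) → IsTree G →
    (P : ParentMap n) → IsSearchTree G P → (D : Designation P) →
    (X : List (Fin n)) →
    ∀ {OPT : ℕ} → IsOPT G X OPT →
    (+ OPT) / 1 ≥ (+ interleaveBound P D X) / 2 - (+ n) / 1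
theorem1 {n} G tree P P-search D X {OPT} opt =
  half-bound (interleaveBound P D X) OPT n
    (LowerBound.interleave-bound G tree P P-search D (IsOPT.achievable opt))
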